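{- Let $\Gamma$ be an Abelian group with $n$ elements, let $S\subseteq\Gamma$ be a covering difference set of $\Gamma$ with $|S|=s$, and let $m\ge 1$ be an integer. Then the bipartite graph $G_m(S)=(V_0\cup V_1,E)$ has $(m+1)n$ vertices, where every vertex in $V_0$ has degree $ms$ and every vertex in $V_1$ has degree $s$. Moreover, the diameter of $G_m(S)$ is $3$.
   Context: Let $\Gamma$ be a finite group (written multiplicatively) and $S\subseteq\Gamma$. $S$ is a covering difference set (covering set) of $\Gamma$ if the multiset of differences $\{t\cdot t'^{ -1} : t,t'\in S\}$ contains all the elements of $\Gamma$ (perhaps with some repetitions). For an integer $m\ge1$, $G_m(S)=(V_0\cup V_1,E)$ is the bipartite graph with independent sets $V_0=\{(0,u):u\in\Gamma\}$ and $V_1=\{(l,v): v\in\Gamma,\ 1\le l\le m\}$, and adjacencies $(l,v)\sim(0,v\cdot\sigma)$ for all $\sigma\in S$, $v\in\Gamma$ and $l\in\{1,\dots,m\}$.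
   Formalization: The diameter is shown to be at most 3 for every covering set S, and exactly 3 only when S ≠ Γ; for S = Γ the printed claim fails, since G_m(Γ) is the complete bipartite graph K_{n,mn}, of diameter at most 2. -}

module Defs where

open import Level using (Level; _⊔_; suc)
open import Algebra.Bundles using (Group)
open import Data.Empty.Polymorphic using (⊥)
open import Data.Fin.Base as Fin using (Fin)
open import Data.Nat.Base as ℕ using (ℕ; _≤_)
open import Data.Product.Base using (Σ; ∃; ∃-syntax; _×_; _,_; proj₁)
open import Data.Product.Relation.Binary.Pointwise.NonDependent using (_×ₛ_)
open import Function.Bundles using (Inverse)
open import Relation.Binary.Bundles using (Setoid)
import Relation.Binary.Construct.On as On
open import Relation.Binary.Core using (Rel)
open import Relation.Binary.Definitions using (Symmetric; _Respects₂_)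
open import Relation.Binary.PropositionalEquality using (refl; setoid)
open import Relation.Nullary.Negation.Core using (¬_)
open import Relation.Unary using (Pred)

private
  variable
    a c p v e ℓ : Level

HasSize : Setoid a ℓ → ℕ → Set (a ⊔ ℓ)
HasSize A n = Inverse A (setoid (Fin n))

-- Elements are compared by their first component only, so the size of
-- `Subsetoid A P` counts elements of A satisfying P, not proofs of P.
Subsetoid : (A : Setoid a ℓ) → Pred (Setoid.Carrier A) p → Setoid (a ⊔ p) ℓ
Subsetoid A P = On.setoid {B = Σ (Setoid.Carrier A) P} A proj₁

-- Simple undirected graphs.
record Graph v ℓ e : Set (suc (v ⊔ ℓ ⊔ e)) where
  field
    V       : Setoid v ℓ
  open Setoid V public using (_≈_) renaming (Carrier to Vertex)
  field
    _~_     : Rel Vertex e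
    ~-resp  : _~_ Respects₂ _≈_
    ~-sym   : Symmetric _~_
    ~-irrefl : ∀ x → ¬ (x ~ x)

module _ (G : Graph v ℓ e) where
  open Graph G

  HasDegree : Vertex → ℕ → Set (v ⊔ ℓ ⊔ e)
  HasDegree x d = HasSize (Subsetoid V (x ~_)) d

  data Walk : Vertex → Vertex → ℕ → Set (v ⊔ ℓ ⊔ e) where
    stop : ∀ {x y} → x ≈ y → Walk x y 0
    step : ∀ {x y z k} → x ~ y → Walk y z k → Walk x z (ℕ.suc k)

  HasDistance : Vertex → Vertex → ℕ → Set (v ⊔ ℓ ⊔ e)
  HasDistance x y d = Walk x y d × (∀ k → Walk x y k → d ≤ k)

  DiameterAtMost : ℕ → Set (v ⊔ ℓ ⊔ e)
  DiameterAtMost d = ∀ x y → ∃[ k ] HasDistance x y k × k ≤ d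

  HasDiameter : ℕ → Set (v ⊔ ℓ ⊔ e)
  HasDiameter d = DiameterAtMost d × (∃[ x ] ∃[ y ] HasDistance x y d)

module _ (Γ : Group c ℓ) where
  open Group Γ using (Carrier; _≈_; _∙_; _⁻¹; trans; sym; ∙-congʳ)
    renaming (setoid to Γ-setoid)

  CoveringSet : Pred Carrier p → Set (c ⊔ ℓ ⊔ p)
  CoveringSet S = ∀ g → ∃[ t ] ∃[ t′ ] S t × S t′ × g ≈ t ∙ t′ ⁻¹

  module _ (S : Pred Carrier p) where

    Translate : Carrier → Carrier → Set (c ⊔ ℓ ⊔ p)
    Translate v u = ∃[ σ ] S σ × u ≈ v ∙ σ

    -- The pair (zero , u) is a vertex of V₀, and (suc l , v) one of V₁;
    -- l : Fin m indexes the copies 1, …, m.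
    Adj : ∀ {m} → Rel (Fin (ℕ.suc m) × Carrier) (c ⊔ ℓ ⊔ p)
    Adj (Fin.zero  , _) (Fin.zero  , _) = ⊥
    Adj (Fin.zero  , u) (Fin.suc _ , v) = Translate v u
    Adj (Fin.suc _ , v) (Fin.zero  , u) = Translate v u
    Adj (Fin.suc _ , _) (Fin.suc _ , _) = ⊥

    private
      translate-resp : ∀ {v v′ u u′} → v ≈ v′ → u ≈ u′ →
                       Translate v u → Translate v′ u′
      translate-resp v≈v′ u≈u′ (σ , σ∈S , u≈vσ) =
        σ , σ∈S , trans (sym u≈u′) (trans u≈vσ (∙-congʳ v≈v′))

    G[_] : ℕ → Graph c ℓ (c ⊔ ℓ ⊔ p)
    G[ m ] = record
      { V        = V
      ; _~_      = Adj
      ; ~-resp   = (λ {x} {y} {y′} → respʳ x {y} {y′})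
                 , (λ {y} {x} {x′} x≈x′ → λ h →
                      symm {y} {x′} (respʳ y {x} {x′} x≈x′ (symm {x} {y} h)))
      ; ~-sym    = λ {x} {y} → symm {x} {y}
      ; ~-irrefl = irrefl
      }
      where
      V = setoid (Fin (ℕ.suc m)) ×ₛ Γ-setoid
      open Setoid V using () renaming (Carrier to Vertex; _≈_ to _≈ᵥ_)

      symm : ∀ {x y : Vertex} → Adj x y → Adj y x
      symm {Fin.zero  , _} {Fin.suc _ , _} h = h
      symm {Fin.suc _ , _} {Fin.zero  , _} h = h

      respʳ : ∀ (x : Vertex) {y y′ : Vertex} → y ≈ᵥ y′ → Adj x y → Adj x y′
      respʳ (Fin.zero  , _) {Fin.suc _ , _} (refl , y≈y′) =
        translate-resp y≈y′ (Group.refl Γ)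
      respʳ (Fin.suc _ , _) {Fin.zero  , _} (refl , y≈y′) =
        translate-resp (Group.refl Γ) y≈y′

      irrefl : ∀ (x : Vertex) → ¬ Adj x x
      irrefl (Fin.zero  , _) ()
      irrefl (Fin.suc _ , _) ()

-- Everything rests on v⁻¹v′ = t t′⁻¹ being solvable with t, t′ ∈ S: then
-- v t = v′ t′ is a common neighbour of (l , v) and (l′ , v′) in V₀ and, by
-- commutativity, (l , v t′⁻¹) is a common neighbour of (0 , v) and (0 , v′).
-- So vertices on the same side are at distance at most 2 and vertices on
-- opposite sides at distance at most 3. If g ∉ S, then (1 , ε) and (0 , g) are
-- not adjacent, and the graph being bipartite puts them at distance exactly 3.
module Submission where

open import Defs
open import Algebra.Bundles using (AbelianGroup; Group)
open import Data.Fin.Base using (Fin; zero; suc)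
open import Data.Nat.Base using (ℕ; _+_; _*_; _≤_; z≤n; s≤s)
open import Data.Product.Base using (∃; ∃-syntax; _×_; _,_; proj₁; proj₂)
open import Relation.Binary.Definitions using (Decidable; _Respects_)
open import Relation.Nullary.Negation.Core using (¬_; contradiction)
open import Relation.Unary using (Pred; Universal)
import Relation.Unary as Unary

import Algebra.Properties.Group as GroupProperties
open import Data.Fin.Properties using (*↔×; any?; ¬∀⟶∃¬; _≟_)
open import Data.Nat.Properties using (+-comm; ≤-refl)
open import Data.Product.Function.NonDependent.Setoid using (_×-inverse_)
open import Data.Product.Relation.Binary.Pointwise.NonDependent
  using (_×ₛ_; ×-decidable; Pointwise-≡↔≡)
open import Function.Base using (_∘_)
open import Function.Bundles using (Inverse)
import Function.Construct.Composition as Composition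
import Function.Construct.Identity as Identity
open import Function.Construct.Symmetry using (↔-sym)
open import Function.Properties.Inverse using (Inverse⇒Injection)
open import Relation.Binary.Bundles using (Setoid)
open import Relation.Binary.PropositionalEquality
  using (refl; subst) renaming (setoid to ≡-setoid)
open import Relation.Nullary.Decidable
  using (yes; no; map′; via-injection)

-- Finite setoids: decidability, counterexamples and products.

module _ {a ℓ} {A : Setoid a ℓ} {n} (size : HasSize A n) where
  open Setoid A
  open Inverse size

  size⇒≈? : Decidable _≈_
  size⇒≈? = via-injection (Inverse⇒Injection size) _≟_

  -- Constructively a counterexample has to be found: it comes from a search through `Fin n`. An
  -- arbitrary `x` is only equivalent to `from (to x)`, hence the use of `resp`. This supplies the
  -- `g` outside `S`.
  ¬universal⇒∃¬ : ∀ {p} {P : Pred Carrier p} → P Respects _≈_ →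
                  Unary.Decidable P → ¬ Universal P → ∃[ x ] ¬ P x
  ¬universal⇒∃¬ {P = P} resp P? ¬all =
    let i , ¬Pi = ¬∀⟶∃¬ n (P ∘ from) (P? ∘ from)
                    (λ all → ¬all (λ x → resp (strictlyInverseʳ x) (all (to x))))
    in from i , ¬Pi

module _ {a ℓ p} {A : Setoid a ℓ} {P : Pred (Setoid.Carrier A) p} where
  open Setoid A

  -- The enumeration lists all members up to `_≈_`, so membership is decided by comparing `x` with
  -- each listed element; `resp` carries the proof over from the listed one.
  size⇒∈? : P Respects _≈_ → Decidable _≈_ →
            ∀ {s} → HasSize (Subsetoid A P) s → Unary.Decidable P
  size⇒∈? resp _≈?_ size x = map′
    (λ (i , eq) → resp eq (proj₂ (from i)))
    (λ Px → to (x , Px) , strictlyInverseʳ (x , Px))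
    (any? (λ i → proj₁ (from i) ≈? x))
    where open Inverse size

-- Serves twice: for the whole vertex set, and for the pairs (copy, element of `S`) that label the
-- neighbours of a vertex of V₀.
size-Fin× : ∀ {a ℓ} {A : Setoid a ℓ} k {n} → HasSize A n →
            HasSize (≡-setoid (Fin k) ×ₛ A) (k * n)
size-Fin× k size =
  Composition.inverse (Identity.inverse _ ×-inverse size)
    (Composition.inverse Pointwise-≡↔≡ (↔-sym *↔×))

-- Distances 0 to 3 in an arbitrary graph.

module _ {v ℓ e} (G : Graph v ℓ e) where
  open Graph G
  private module V = Setoid V

  walk₀⇒≈ : ∀ {x y} → Walk G x y 0 → x ≈ y
  walk₀⇒≈ (stop x≈y) = x≈y

  walk₁⇒~ : ∀ {x y} → Walk G x y 1 → x ~ y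
  walk₁⇒~ (step x~z (stop z≈y)) = proj₁ ~-resp z≈y x~z

  ≈⇒distance₀ : ∀ {x y} → x ≈ y → HasDistance G x y 0
  ≈⇒distance₀ x≈y = stop x≈y , λ _ _ → z≤n

  ~⇒≉ : ∀ {x y} → x ~ y → ¬ x ≈ y
  ~⇒≉ x~y x≈y = ~-irrefl _ (proj₁ ~-resp (V.sym x≈y) x~y)

  ~⇒distance₁ : ∀ {x y} → x ~ y → HasDistance G x y 1
  ~⇒distance₁ {x} {y} x~y = step x~y (stop V.refl) , least
    where
    least : ∀ k → Walk G x y k → 1 ≤ k
    least 0       w = contradiction (walk₀⇒≈ w) (~⇒≉ x~y)
    least (ℕ.suc _) _ = s≤s z≤n

  ≉∧≁⇒distance₂ : ∀ {x y} → ¬ x ≈ y → ¬ x ~ y → Walk G x y 2 →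
                  HasDistance G x y 2
  ≉∧≁⇒distance₂ {x} {y} x≉y x≁y w = w , least
    where
    least : ∀ k → Walk G x y k → 2 ≤ k
    least 0 w                 = contradiction (walk₀⇒≈ w) x≉y
    least 1 w                 = contradiction (walk₁⇒~ w) x≁y
    least (ℕ.suc (ℕ.suc _)) _ = s≤s (s≤s z≤n)

  -- Minimality amounts to excluding the lengths 0, 1 and 2 one by one; for `G[ m ]`, parity takes
  -- care of length 2.
  noShortWalk⇒distance₃ : ∀ {x y} → ¬ x ≈ y → ¬ x ~ y → ¬ Walk G x y 2 →
                          Walk G x y 3 → HasDistance G x y 3
  noShortWalk⇒distance₃ {x} {y} x≉y x≁y no₂ w = w , least
    where
    least : ∀ k → Walk G x y k → 3 ≤ k
    least 0 w                         = contradiction (walk₀⇒≈ w) x≉y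
    least 1 w                         = contradiction (walk₁⇒~ w) x≁y
    least 2 w                         = contradiction w no₂
    least (ℕ.suc (ℕ.suc (ℕ.suc _))) _ = s≤s (s≤s (s≤s z≤n))

-- Right translates by elements of S.

module _ {c ℓ p} (Γ : Group c ℓ) (S : Pred (Group.Carrier Γ) p) where
  open Group Γ renaming (setoid to Γ-setoid; refl to ≈-refl)
  open GroupProperties Γ using
    ( ∙-cancelˡ; x≈z//y; y≈x\\z
    ; \\-leftDividesˡ; //-rightDividesˡ )
  open import Relation.Binary.Reasoning.Setoid Γ-setoid

  translate-by : ∀ {v σ} → S σ → Translate Γ S v (v ∙ σ)
  translate-by σ∈S = _ , σ∈S , ≈-refl

  translate-from : ∀ {u σ} → S σ → Translate Γ S (u // σ) u
  translate-from {u} {σ} σ∈S = σ , σ∈S , sym (//-rightDividesˡ σ u)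

  ∈⇒translate : ∀ {v u} → S (v \\ u) → Translate Γ S v u
  ∈⇒translate {v} {u} h = v \\ u , h , sym (\\-leftDividesˡ v u)

  module _ (S-resp : S Respects _≈_) where

    -- Cancellation forces σ = v⁻¹u, so adjacency is settled by one membership test instead of a
    -- search for σ.
    translate⇒∈ : ∀ {v u} → Translate Γ S v u → S (v \\ u)
    translate⇒∈ {v} {u} (σ , σ∈S , u≈vσ) =
      S-resp (y≈x\\z v σ u (sym u≈vσ)) σ∈S

    translate? : Unary.Decidable S → Decidable (Translate Γ S)
    translate? S? v u = map′ ∈⇒translate translate⇒∈ (S? (v \\ u))

  -- Representing any element, here `ε`, as a difference exhibits members of `S`. Such a member
  -- provides the first edge of a walk of length 3.
  cover⇒∈ : CoveringSet Γ S → ∃ S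
  cover⇒∈ cover = let t , _ , t∈S , _ = cover ε in t , t∈S

  cover⇒common-target : CoveringSet Γ S → ∀ v v′ →
                        ∃[ u ] Translate Γ S v u × Translate Γ S v′ u
  cover⇒common-target cover v v′ =
    let t , t′ , t∈S , t′∈S , eq = cover (v \\ v′)
        v′t′≈vt = begin
          v′ ∙ t′                ≈⟨ ∙-congʳ (\\-leftDividesˡ v v′) ⟨
          v ∙ (v \\ v′) ∙ t′     ≈⟨ ∙-congʳ (∙-congˡ eq) ⟩
          v ∙ (t // t′) ∙ t′     ≈⟨ assoc v _ t′ ⟩
          v ∙ ((t // t′) ∙ t′)   ≈⟨ ∙-congˡ (//-rightDividesˡ t′ t) ⟩
          v ∙ t                  ∎
    in v ∙ t , translate-by t∈S , (t′ , t′∈S , sym v′t′≈vt)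

  -- Degrees, and parity of walks.

  module _ (m : ℕ) where
    private
      G = G[_] Γ S m
      module G = Graph G

    -- A neighbour is recorded by its label σ. Neighbours are counted up to equality of vertices,
    -- and left cancellation makes the label depend on the vertex alone.
    degree-V₁ : ∀ {s} → HasSize (Subsetoid Γ-setoid S) s →
                ∀ l v → HasDegree G (suc l , v) s
    degree-V₁ size l v = Composition.inverse labels size
      where
      labels : Inverse (Subsetoid G.V (G._~_ (suc l , v))) (Subsetoid Γ-setoid S)
      labels = record
        { to        = λ { ((zero , u) , σ , σ∈S , _) → σ , σ∈S }
        ; from      = λ (σ , σ∈S) → (zero , v ∙ σ) , translate-by σ∈S
        ; to-cong   = λ
          { {(zero , u) , σ , _ , u≈vσ} {(zero , u′) , σ′ , _ , u′≈vσ′} (_ , u≈u′) →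
              ∙-cancelˡ v σ σ′ (trans (sym u≈vσ) (trans u≈u′ u′≈vσ′)) }
        ; from-cong = λ eq → refl , ∙-congˡ eq
        ; inverse   =
            (λ { {σ , _} {(zero , u) , τ , _ , u≈vτ} (_ , u≈vσ) →
                 ∙-cancelˡ v τ σ (trans (sym u≈vτ) u≈vσ) })
          , (λ { {(zero , u) , σ , _ , u≈vσ} eq →
                 refl , trans (∙-congˡ eq) (sym u≈vσ) })
        }

    -- The neighbours of (0 , u) are the vertices (l , uσ⁻¹), one for each copy l and each σ in `S`.
    degree-V₀ : ∀ {s} → HasSize (Subsetoid Γ-setoid S) s →
                ∀ u → HasDegree G (zero , u) (m * s)
    degree-V₀ size u = Composition.inverse labels (size-Fin× m size)
      where
      labels : Inverse (Subsetoid G.V (G._~_ (zero , u)))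
                       (≡-setoid (Fin m) ×ₛ Subsetoid Γ-setoid S)
      labels = record
        { to        = λ { ((suc l , v) , σ , σ∈S , _) → l , σ , σ∈S }
        ; from      = λ (l , σ , σ∈S) → (suc l , u // σ) , translate-from σ∈S
        ; to-cong   = λ
          { {(suc l , v) , σ , _ , u≈vσ} {(suc l′ , v′) , σ′ , _ , u≈v′σ′} (refl , v≈v′) →
              refl , ∙-cancelˡ v σ σ′
                       (trans (sym u≈vσ) (trans u≈v′σ′ (∙-congʳ (sym v≈v′)))) }
        ; from-cong = λ { (refl , eq) → refl , ∙-congˡ (⁻¹-cong eq) }
        ; inverse   =
            (λ { {l , σ , _} {(suc _ , v) , τ , _ , u≈vτ} (refl , v≈u//σ) →
                 refl , ∙-cancelˡ v τ σ (trans (sym u≈vτ)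
                   (sym (trans (∙-congʳ v≈u//σ) (//-rightDividesˡ σ u)))) })
          , (λ { {(suc l , v) , σ , _ , u≈vσ} {_ , τ , _} (refl , τ≈σ) →
                 refl , trans (∙-congˡ (⁻¹-cong τ≈σ)) (sym (x≈z//y v σ u (sym u≈vσ))) })
        }

    -- Every edge changes sides, so two steps lead back to the side of the start.
    ¬walk₂-V₁V₀ : ∀ {l v u} → ¬ Walk G (suc l , v) (zero , u) 2
    ¬walk₂-V₁V₀ (step {y = zero , _} _ (step {y = zero , _} () _))
    ¬walk₂-V₁V₀ (step {y = zero , _} _ (step {y = suc _ , _} _ (stop (() , _))))
    ¬walk₂-V₁V₀ (step {y = suc _ , _} () _)

    ¬walk₂-V₀V₁ : ∀ {l v u} → ¬ Walk G (zero , u) (suc l , v) 2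
    ¬walk₂-V₀V₁ (step {y = suc _ , _} _ (step {y = suc _ , _} () _))
    ¬walk₂-V₀V₁ (step {y = suc _ , _} _ (step {y = zero , _} _ (stop (() , _))))
    ¬walk₂-V₀V₁ (step {y = zero , _} () _)

-- Walks and distances over an abelian group.

module _ {c ℓ p} (Γ : AbelianGroup c ℓ) (S : Pred (AbelianGroup.Carrier Γ) p)
         (cover : CoveringSet (AbelianGroup.group Γ) S) where
  open AbelianGroup Γ hiding (refl)
  open GroupProperties group using (\\-leftDividesˡ)
  open import Relation.Binary.Reasoning.Setoid setoid hiding (stop)

  cover⇒common-source : ∀ u u′ →
    ∃[ v ] Translate group S v u × Translate group S v u′
  cover⇒common-source u u′ =
    let t , t′ , t∈S , t′∈S , eq = cover (u ⁻¹ ∙ u′)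
        u′≈vt = begin
          u′                   ≈⟨ \\-leftDividesˡ u u′ ⟨
          u ∙ (u ⁻¹ ∙ u′)      ≈⟨ ∙-congˡ eq ⟩
          -- Commutativity enters here: `t` must come last for u′ to be a right translate of ut′⁻¹.
          u ∙ (t ∙ t′ ⁻¹)      ≈⟨ ∙-congˡ (comm t (t′ ⁻¹)) ⟩
          u ∙ (t′ ⁻¹ ∙ t)      ≈⟨ assoc u (t′ ⁻¹) t ⟨
          u ∙ t′ ⁻¹ ∙ t        ∎
    in u ∙ t′ ⁻¹ , translate-from group S t′∈S , (t , t∈S , u′≈vt)

  module _ (m : ℕ) where
    private
      G = G[_] group S m
      module G = Graph G
      module V = Setoid G.V

    walk₂-V₀V₀ : Fin m → ∀ u u′ → Walk G (zero , u) (zero , u′) 2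
    walk₂-V₀V₀ l u u′ =
      let v , v→u , v→u′ = cover⇒common-source u u′
      in step {y = suc l , v} v→u (step v→u′ (stop V.refl))

    walk₂-V₁V₁ : ∀ l v l′ v′ → Walk G (suc l , v) (suc l′ , v′) 2
    walk₂-V₁V₁ l v l′ v′ =
      let u , v→u , v′→u = cover⇒common-target group S cover v v′
      in step {y = zero , u} v→u (step v′→u (stop V.refl))

    -- One edge to any neighbour of the start reaches the side of the target, where two more steps
    -- suffice.
    walk₃-V₀V₁ : ∀ u l v → Walk G (zero , u) (suc l , v) 3
    walk₃-V₀V₁ u l v =
      let t , t∈S = cover⇒∈ group S cover
      in step {y = suc l , u ∙ t ⁻¹} (translate-from group S t∈S)
              (walk₂-V₁V₁ l _ l v)

    walk₃-V₁V₀ : ∀ l v u → Walk G (suc l , v) (zero , u) 3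
    walk₃-V₁V₀ l v u =
      let t , t∈S = cover⇒∈ group S cover
      in step {y = zero , v ∙ t} (translate-by group S t∈S)
              (walk₂-V₀V₀ l _ u)

    distance₃-V₁V₀ : ∀ {l v u} → ¬ Translate group S v u →
                     HasDistance G (suc l , v) (zero , u) 3
    distance₃-V₁V₀ {l} {v} {u} v↛u =
      noShortWalk⇒distance₃ G (λ ()) v↛u (¬walk₂-V₁V₀ group S m) (walk₃-V₁V₀ l v u)

    distance₃-V₀V₁ : ∀ {l v u} → ¬ Translate group S v u →
                     HasDistance G (zero , u) (suc l , v) 3
    distance₃-V₀V₁ {l} {v} {u} v↛u =
      noShortWalk⇒distance₃ G (λ ()) v↛u (¬walk₂-V₀V₁ group S m) (walk₃-V₀V₁ u l v)

    module _ (l₀ : Fin m) (_≈?_ : Decidable _≈_)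
             (_→?_ : Decidable (Translate group S)) where

      -- `DiameterAtMost` asks for exact distances, so equality must be decided to tell 0 from 2 on
      -- one side, and adjacency to tell 1 from 3 across the sides.
      diameter≤3 : DiameterAtMost G 3
      diameter≤3 (zero , u) (zero , u′) with u ≈? u′
      ... | yes u≈u′ = 0 , ≈⇒distance₀ G (refl , u≈u′) , z≤n
      ... | no  u≉u′ =
        2 , ≉∧≁⇒distance₂ G (u≉u′ ∘ proj₂) (λ ()) (walk₂-V₀V₀ l₀ u u′) , s≤s (s≤s z≤n)
      diameter≤3 (zero , u) (suc l , v) with v →? u
      ... | yes v→u = 1 , ~⇒distance₁ G v→u , s≤s z≤n
      ... | no  v↛u = 3 , distance₃-V₀V₁ v↛u , ≤-refl
      diameter≤3 (suc l , v) (zero , u) with v →? u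
      ... | yes v→u = 1 , ~⇒distance₁ G v→u , s≤s z≤n
      ... | no  v↛u = 3 , distance₃-V₁V₀ v↛u , ≤-refl
      diameter≤3 (suc l , v) (suc l′ , v′) with ×-decidable _≟_ _≈?_ (suc l , v) (suc l′ , v′)
      ... | yes eq = 0 , ≈⇒distance₀ G eq , z≤n
      ... | no neq =
        2 , ≉∧≁⇒distance₂ G neq (λ ()) (walk₂-V₁V₁ l v l′ v′) , s≤s (s≤s z≤n)

proposition2p2 : ∀ {c ℓ p} (Γ : AbelianGroup c ℓ) →
    let open AbelianGroup Γ in
    (n : ℕ) → HasSize setoid n →
    (S : Pred Carrier p) → S Respects _≈_ →
    CoveringSet group S →
    (s : ℕ) → HasSize (Subsetoid setoid S) s →
    (m : ℕ) → 1 ≤ m →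
    let G = G[_] group S m in
    HasSize (Graph.V G) ((m + 1) * n)
    × (∀ (u : Carrier) → HasDegree G (zero , u) (m * s))
    × (∀ (l : Fin m) (v : Carrier) → HasDegree G (suc l , v) s)
    × DiameterAtMost G 3
    × (¬ Universal S → HasDiameter G 3)
proposition2p2 Γ n Γ-size S S-resp cover s S-size m@(ℕ.suc _) _ =
    -- The vertices are indexed by `Fin (ℕ.suc m)`, which gives 1 + m rather than m + 1.
    subst (λ k → HasSize (Graph.V G) (k * n)) (+-comm 1 m) (size-Fin× (1 + m) Γ-size)
  , degree-V₀ group S m S-size
  , degree-V₁ group S m S-size
  , atMost3
  -- If `S` were all of Γ, the graph would be complete bipartite, of diameter at most 2; so
  -- attaining 3 calls for an element outside `S`.
  , λ S≢Γ →
      let g , g∉S = ¬universal⇒∃¬ Γ-size S-resp S? S≢Γ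
      in atMost3 , (suc zero , ε) , (zero , g) ,
         -- An edge from (1 , ε) to (0 , g) would make g = εσ = σ a member of `S`.
         distance₃-V₁V₀ Γ S cover m (λ (σ , σ∈S , g≈εσ) →
           g∉S (S-resp (sym (trans g≈εσ (identityˡ σ))) σ∈S))
  where
  open AbelianGroup Γ hiding (refl)
  G = G[_] group S m

  _≈?_ : Decidable _≈_
  _≈?_ = size⇒≈? Γ-size

  S? : Unary.Decidable S
  S? = size⇒∈? S-resp _≈?_ S-size

  atMost3 : DiameterAtMost G 3
  -- As m is a successor, `zero` names a copy of Γ in V₁, in which the common neighbours of V₀
  -- vertices are taken.
  atMost3 = diameter≤3 Γ S cover m zero _≈?_ (translate? group S S-resp S?)
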